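{- Let $F(t)=\frac{1}{2}(t^2-t+1)$ and $G(t)=\frac{1}{4}(t^2+t+1)(t^2-t+3)$. Let $f,g\in\mathbb{Q}[t]$ with $\deg f=2$, $\deg g=4$, and call $(f,g)$ a solution if $g$ divides $f^3+1$ and $f$ divides $g^3+1$ in $\mathbb{Q}[t]$. Call $(f,g)$ trivial if there exist $f_1,g_1,h\in\mathbb{Q}[t]$ with $\deg h\ge 2$ such that $f=f_1\circ h$ and $g=g_1\circ h$. Then $(f,g)$ is a non-trivial solution if and only if there exist $\alpha\in\mathbb{Q}\setminus\{0\}$ and $\beta\in\mathbb{Q}$ such that $f(t)=F(\alpha t+\beta)$ and $g(t)=G(\alpha t+\beta)$.
   Context: Non-trivial solutions are considered only up to affine reparametrization $t\mapsto\alpha t+\beta$ with $\alpha\in\mathbb{Q}\setminus\{0\}$, $\beta\in\mathbb{Q}$. -}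

module Defs where

open import Data.Nat using (ℕ; zero; suc; _≤_)
open import Data.Integer using (+_)
open import Data.Rational using (ℚ; 0ℚ; 1ℚ; _/_; _+_; _*_) renaming (-_ to -ℚ_)
open import Data.List using (List; []; _∷_; map)
open import Data.List.Relation.Unary.All using (All)
open import Data.Product using (Σ; ∃; _×_)
open import Data.Empty using (⊥)
open import Relation.Binary.PropositionalEquality using (_≡_; _≢_)
open import Relation.Nullary using (¬_)

-- Polynomials in ℚ[t] as coefficient lists, lowest degree first
-- (trailing zeros allowed; equality is taken up to trailing zeros).
Poly : Set
Poly = List ℚ

IsZeroₚ : Poly → Set
IsZeroₚ p = All (_≡ 0ℚ) p

infix 4 _≈ₚ_
_≈ₚ_ : Poly → Poly → Set
[] ≈ₚ q = IsZeroₚ q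
(a ∷ p) ≈ₚ [] = IsZeroₚ (a ∷ p)
(a ∷ p) ≈ₚ (b ∷ q) = (a ≡ b) × (p ≈ₚ q)

infixl 6 _+ₚ_
_+ₚ_ : Poly → Poly → Poly
[] +ₚ q = q
(a ∷ p) +ₚ [] = a ∷ p
(a ∷ p) +ₚ (b ∷ q) = (a + b) ∷ (p +ₚ q)

scaleₚ : ℚ → Poly → Poly
scaleₚ c p = map (c *_) p

infixl 7 _*ₚ_
_*ₚ_ : Poly → Poly → Poly
[] *ₚ q = []
(a ∷ p) *ₚ q = scaleₚ a q +ₚ (0ℚ ∷ (p *ₚ q))

constₚ : ℚ → Poly
constₚ c = c ∷ []

cubeₚ : Poly → Poly
cubeₚ p = p *ₚ p *ₚ p

infixr 9 _∘ₚ_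
_∘ₚ_ : Poly → Poly → Poly
[] ∘ₚ h = []
(a ∷ p) ∘ₚ h = constₚ a +ₚ h *ₚ (p ∘ₚ h)

infix 4 _∣ₚ_
_∣ₚ_ : Poly → Poly → Set
g ∣ₚ p = Σ Poly (λ q → p ≈ₚ g *ₚ q)

HasDegree : Poly → ℕ → Set
HasDegree [] n = ⊥
HasDegree (a ∷ p) zero = (a ≢ 0ℚ) × IsZeroₚ p
HasDegree (a ∷ p) (suc n) = HasDegree p n

linₚ : ℚ → ℚ → Poly
linₚ α β = β ∷ α ∷ []

IsSolution : Poly → Poly → Set
IsSolution f g = (g ∣ₚ cubeₚ f +ₚ constₚ 1ℚ) × (f ∣ₚ cubeₚ g +ₚ constₚ 1ℚ)

Trivial : Poly → Poly → Set
Trivial f g = Σ Poly λ f₁ → Σ Poly λ g₁ → Σ Poly λ h →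
  (Σ ℕ λ n → (2 ≤ n) × HasDegree h n) × (f ≈ₚ f₁ ∘ₚ h) × (g ≈ₚ g₁ ∘ₚ h)

Fₚ : Poly
Fₚ = scaleₚ (+ 1 / 2) (1ℚ ∷ (-ℚ 1ℚ) ∷ 1ℚ ∷ [])

Gₚ : Poly
Gₚ = scaleₚ (+ 1 / 4) ((1ℚ ∷ 1ℚ ∷ 1ℚ ∷ []) *ₚ ((+ 3 / 1) ∷ (-ℚ 1ℚ) ∷ 1ℚ ∷ []))

{-# OPTIONS --safe #-}
-- Write f³ + 1 = g e with deg e = 2.  A quadratic e dividing a³ + 1 with deg a ≤ 2 forces either
-- a = l e − 1, or a = l e + t with t linear, non-constant and t² − t + 1 = μ e, because −1 is the
-- only rational cube root of −1.  Apply this to e ∣ f³ + 1: in the first case g = l (f² − f + 1)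
-- is a polynomial in f, so (f , g) is trivial; otherwise f² − f + 1 = e q and g = (f + 1) q.
-- Now f divides q³ + 1, since g ≡ q modulo f.  Again either q = l f − 1 and (f , g) is trivial,
-- or q = l f + t with t linear and f = ν (t² − t + 1).  Comparing the coefficients in t of
-- f² − f + 1 = e q leaves only ν = ½ and l = 1, that is f = F(t) and g = G(t).
module Submission where

open import Defs
open import Data.Empty using (⊥-elim)
open import Data.Integer using (+_)
open import Data.List using ([]; _∷_; length)
open import Data.List.Relation.Unary.All using ([]; _∷_)
open import Data.Nat as ℕ using (ℕ; zero; suc; s≤s)
import Data.Nat.Properties as ℕₚ
open import Data.Product using (Σ; _×_; _,_; proj₁; proj₂)
open import Data.Rational using (ℚ; 0ℚ; 1ℚ; ½; _+_; _*_; -_; _-_; _/_; _≤_; _<_; 1/_)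
open import Data.Rational using (≢-nonZero; nonNegative; nonPositive)
open import Data.Rational.Properties
open import Data.Sum using (_⊎_; inj₁; inj₂)
open import Data.Unit using (⊤; tt)
open import Function.Bundles using (_⇔_; mk⇔)
open import Level using (0ℓ)
open import Relation.Binary.PropositionalEquality using (_≡_; _≢_; refl; sym; trans; cong; cong₂; subst)
open import Relation.Nullary using (¬_; Dec; yes; no)
open import Relation.Nullary.Decidable using (dec⇒maybe)
open import Tactic.RingSolver using (solve-∀)
open import Tactic.RingSolver.Core.AlmostCommutativeRing using (AlmostCommutativeRing; fromCommutativeRing)

-- Rational arithmetic and ideal-membership certificates.

ring : AlmostCommutativeRing 0ℓ 0ℓ
ring = fromCommutativeRing +-*-commutativeRing (λ x → dec⇒maybe (0ℚ ≟ x))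

x-y≡0⇒x≡y : ∀ {x y} → x - y ≡ 0ℚ → x ≡ y
x-y≡0⇒x≡y {x} {y} x-y≡0 = trans (lem x y) (trans (cong (_+ y) x-y≡0) (+-identityˡ y))
  where
  lem : ∀ x y → x ≡ (x - y) + y
  lem = solve-∀ ring

-- Ideal membership as a proof rule: the ring solver checks the certificate a − b = k (p − q).
comb₁ : ∀ {a b p q} k → p ≡ q → a - b ≡ k * (p - q) → a ≡ b
comb₁ {p = p} k refl eq = x-y≡0⇒x≡y (trans eq (lem k p))
  where
  lem : ∀ k p → k * (p - p) ≡ 0ℚ
  lem = solve-∀ ring

comb₂ : ∀ {a b p q p′ q′} k → p ≡ q → ∀ k′ → p′ ≡ q′ →
        a - b ≡ k * (p - q) + k′ * (p′ - q′) → a ≡ b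
comb₂ {p = p} {p′ = p′} k refl k′ refl eq = x-y≡0⇒x≡y (trans eq (lem k p k′ p′))
  where
  lem : ∀ k p k′ p′ → k * (p - p) + k′ * (p′ - p′) ≡ 0ℚ
  lem = solve-∀ ring

comb₃ : ∀ {a b p q p′ q′ p″ q″} k → p ≡ q → ∀ k′ → p′ ≡ q′ → ∀ k″ → p″ ≡ q″ →
        a - b ≡ k * (p - q) + k′ * (p′ - q′) + k″ * (p″ - q″) → a ≡ b
comb₃ {p = p} {p′ = p′} {p″ = p″} k refl k′ refl k″ refl eq = x-y≡0⇒x≡y (trans eq (lem k p k′ p′ k″ p″))
  where
  lem : ∀ k p k′ p′ k″ p″ → k * (p - p) + k′ * (p′ - p′) + k″ * (p″ - p″) ≡ 0ℚ
  lem = solve-∀ ring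

inverse : ∀ {a} → a ≢ 0ℚ → Σ ℚ λ k → k * a ≡ 1ℚ
inverse {a} a≢0 = 1/ a , *-inverseˡ a
  where instance _ = ≢-nonZero a≢0

*-cancel-0 : ∀ {a b} → a ≢ 0ℚ → a * b ≡ 0ℚ → b ≡ 0ℚ
*-cancel-0 {a} {b} a≢0 ab≡0 with inverse a≢0
... | k , ka≡1 = comb₂ (- b) ka≡1 k ab≡0 (lem a b k)
  where
  lem : ∀ a b k → b - 0ℚ ≡ (- b) * (k * a - 1ℚ) + k * (a * b - 0ℚ)
  lem = solve-∀ ring

x*x≥0 : ∀ x → 0ℚ ≤ x * x
x*x≥0 x with ≤-total 0ℚ x
... | inj₁ 0≤x = nonNegative⁻¹ (x * x) {{nonNeg*nonNeg⇒nonNeg x {{nonNegative 0≤x}} x {{nonNegative 0≤x}}}}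
... | inj₂ x≤0 = nonNegative⁻¹ (x * x) {{nonPos*nonPos⇒nonPos x {{nonPositive x≤0}} x {{nonPositive x≤0}}}}

-- Completing the square gives (x - ½)² + ¾, which is positive.
x²-x+1≢0 : ∀ x → x * x - x + 1ℚ ≢ 0ℚ
x²-x+1≢0 x eq = <⇒≢ (+-mono-≤-< (x*x≥0 (x - ½)) (positive⁻¹ (+ 3 / 4))) (sym (trans (lem x) eq))
  where
  lem : ∀ x → (x - ½) * (x - ½) + (+ 3 / 4) ≡ x * x - x + 1ℚ
  lem = solve-∀ ring

-- The cofactor x² + x + 1 of x - 1 in x³ - 1 is y² - y + 1 at y = -x, hence non-zero.
x³≡1⇒x≡1 : ∀ x → x * x * x ≡ 1ℚ → x ≡ 1ℚ
x³≡1⇒x≡1 x x³≡1 = x-y≡0⇒x≡y (*-cancel-0 (x²-x+1≢0 (- x)) (trans (lem x) (cong (_- 1ℚ) x³≡1)))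
  where
  lem : ∀ x → ((- x) * (- x) - (- x) + 1ℚ) * (x - 1ℚ) ≡ x * x * x - 1ℚ
  lem = solve-∀ ring

-- Evaluation as a ring homomorphism.

⟦_⟧ : Poly → ℚ → ℚ
⟦ [] ⟧ x = 0ℚ
⟦ a ∷ p ⟧ x = a + x * ⟦ p ⟧ x

eval-+ : ∀ p q x → ⟦ p +ₚ q ⟧ x ≡ ⟦ p ⟧ x + ⟦ q ⟧ x
eval-+ [] q x = sym (+-identityˡ _)
eval-+ (a ∷ p) [] x = sym (+-identityʳ _)
eval-+ (a ∷ p) (b ∷ q) x = trans (cong (λ s → a + b + x * s) (eval-+ p q x)) (lem a b x _ _)
  where
  lem : ∀ a b x u v → a + b + x * (u + v) ≡ a + x * u + (b + x * v)
  lem = solve-∀ ring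

eval-scale : ∀ c p x → ⟦ scaleₚ c p ⟧ x ≡ c * ⟦ p ⟧ x
eval-scale c [] x = sym (*-zeroʳ c)
eval-scale c (a ∷ p) x = trans (cong (λ s → c * a + x * s) (eval-scale c p x)) (lem a c x _)
  where
  lem : ∀ a c x u → c * a + x * (c * u) ≡ c * (a + x * u)
  lem = solve-∀ ring

eval-* : ∀ p q x → ⟦ p *ₚ q ⟧ x ≡ ⟦ p ⟧ x * ⟦ q ⟧ x
eval-* [] q x = sym (*-zeroˡ (⟦ q ⟧ x))
eval-* (a ∷ p) q x =
  trans (eval-+ (scaleₚ a q) (0ℚ ∷ p *ₚ q) x)
    (trans (cong₂ (λ s t → s + (0ℚ + x * t)) (eval-scale a q x) (eval-* p q x)) (lem a x _ _))
  where
  lem : ∀ a x u v → a * v + (0ℚ + x * (u * v)) ≡ (a + x * u) * v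
  lem = solve-∀ ring

eval-const : ∀ c x → ⟦ constₚ c ⟧ x ≡ c
eval-const c x = trans (cong (λ s → c + s) (*-zeroʳ x)) (+-identityʳ c)

eval-∘ : ∀ p h x → ⟦ p ∘ₚ h ⟧ x ≡ ⟦ p ⟧ (⟦ h ⟧ x)
eval-∘ [] h x = refl
eval-∘ (a ∷ p) h x =
  trans (eval-+ (constₚ a) (h *ₚ (p ∘ₚ h)) x)
    (cong₂ _+_ (eval-const a x) (trans (eval-* h (p ∘ₚ h) x) (cong (⟦ h ⟧ x *_) (eval-∘ p h x))))

eval-cube+1 : ∀ p x → ⟦ cubeₚ p +ₚ constₚ 1ℚ ⟧ x ≡ ⟦ p ⟧ x * ⟦ p ⟧ x * ⟦ p ⟧ x + 1ℚ
eval-cube+1 p x =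
  trans (eval-+ (cubeₚ p) (constₚ 1ℚ) x)
    (cong₂ _+_ (trans (eval-* (p *ₚ p) p x) (cong (_* ⟦ p ⟧ x) (eval-* p p x))) (eval-const 1ℚ x))

eval-zero : ∀ {p} → IsZeroₚ p → ∀ x → ⟦ p ⟧ x ≡ 0ℚ
eval-zero [] x = refl
eval-zero (refl ∷ z) x = trans (+-identityˡ _) (trans (cong (x *_) (eval-zero z x)) (*-zeroʳ x))

≈⇒eval : ∀ p q → p ≈ₚ q → ∀ x → ⟦ p ⟧ x ≡ ⟦ q ⟧ x
≈⇒eval [] q z x = sym (eval-zero z x)
≈⇒eval (a ∷ p) [] z x = eval-zero z x
≈⇒eval (a ∷ p) (b ∷ q) (refl , e) x = cong (λ s → a + x * s) (≈⇒eval p q e x)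

-- Root division and the identity principle for polynomials.

-- Synthetic division by t - c: the coefficients of the quotient are the Horner values at c of the
-- successive tails, and the remainder is the value at c.
quot : Poly → ℚ → Poly
quot [] c = []
quot (a ∷ []) c = []
quot (a ∷ p@(_ ∷ _)) c = ⟦ p ⟧ c ∷ quot p c

eval-quot : ∀ p c x → ⟦ p ⟧ x ≡ ⟦ p ⟧ c + (x - c) * ⟦ quot p c ⟧ x
eval-quot [] c x = lem c x
  where
  lem : ∀ c x → 0ℚ ≡ 0ℚ + (x - c) * 0ℚ
  lem = solve-∀ ring
eval-quot (a ∷ []) c x = lem a c x
  where
  lem : ∀ a c x → a + x * 0ℚ ≡ a + c * 0ℚ + (x - c) * 0ℚ
  lem = solve-∀ ring
eval-quot (a ∷ p@(_ ∷ _)) c x = trans (cong (λ s → a + x * s) (eval-quot p c x)) (lem a c x _ _)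
  where
  lem : ∀ a c x u v → a + x * (u + (x - c) * v) ≡ a + c * u + (x - c) * (u + x * v)
  lem = solve-∀ ring

quot-zero : ∀ p c → ⟦ p ⟧ c ≡ 0ℚ → IsZeroₚ (quot p c) → IsZeroₚ p
quot-zero [] c _ _ = []
quot-zero (a ∷ []) c pc≡0 _ = trans (sym (eval-const a c)) pc≡0 ∷ []
quot-zero (a ∷ p@(_ ∷ _)) c pc≡0 (e ∷ z) =
  comb₂ 1ℚ pc≡0 (- c) e (lem a c (⟦ p ⟧ c)) ∷ quot-zero p c e z
  where
  lem : ∀ a c u → a - 0ℚ ≡ 1ℚ * (a + c * u - 0ℚ) + (- c) * (u - 0ℚ)
  lem = solve-∀ ring

length-quot : ∀ a p c → length (quot (a ∷ p) c) ≡ length p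
length-quot a [] c = refl
length-quot a (b ∷ p) c = cong suc (length-quot b p c)

x<x+1 : ∀ x → x < x + 1ℚ
x<x+1 x = subst (_< x + 1ℚ) (+-identityʳ x) (+-mono-≤-< (≤-refl {x}) (positive⁻¹ 1ℚ))

-- Dividing out the root `c + 1` shortens the list, and the quotient vanishes for all x > c + 1,
-- where x - (c + 1) can be cancelled. Vanishing on a half-line is a condition that survives this
-- step.
vanishing⇒zero : ∀ n p c → length p ≡ n → (∀ x → c < x → ⟦ p ⟧ x ≡ 0ℚ) → IsZeroₚ p
vanishing⇒zero n [] c _ _ = []
vanishing⇒zero (suc n) p@(a ∷ p′) c len vanish =
  quot-zero p d pd≡0 (vanishing⇒zero n (quot p d) d (trans (length-quot a p′ d) (ℕₚ.suc-injective len)) vanish′)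
  where
  d : ℚ
  d = c + 1ℚ
  pd≡0 : ⟦ p ⟧ d ≡ 0ℚ
  pd≡0 = vanish d (x<x+1 c)
  vanish′ : ∀ x → d < x → ⟦ quot p d ⟧ x ≡ 0ℚ
  vanish′ x d<x = *-cancel-0 {x - d} (λ eq → <⇒≢ d<x (sym (x-y≡0⇒x≡y eq)))
    (trans (sym (+-identityˡ _)) (trans (cong (_+ (x - d) * ⟦ quot p d ⟧ x) (sym pd≡0))
      (trans (sym (eval-quot p d x)) (vanish x (<-trans (x<x+1 c) d<x)))))

-- The difference has infinitely many roots. This lets polynomial identities be checked pointwise,
-- by the ring solver, and read off coefficientwise.
eval⇒≈ : ∀ p q → (∀ x → ⟦ p ⟧ x ≡ ⟦ q ⟧ x) → p ≈ₚ q
eval⇒≈ p q eq = minus-zero p q (vanishing⇒zero _ (p +ₚ scaleₚ (- 1ℚ) q) 0ℚ refl λ x _ →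
  trans (eval-+ p _ x) (trans (cong₂ _+_ (eq x) (eval-scale (- 1ℚ) q x)) (lem (⟦ q ⟧ x))))
  where
  lem : ∀ u → u + - 1ℚ * u ≡ 0ℚ
  lem = solve-∀ ring
  lem₂ : ∀ u → u - 0ℚ ≡ - 1ℚ * (- 1ℚ * u - 0ℚ)
  lem₂ = solve-∀ ring
  lem₃ : ∀ a b → a - b ≡ 1ℚ * (a + - 1ℚ * b - 0ℚ)
  lem₃ = solve-∀ ring
  scale-zero : ∀ q → IsZeroₚ (scaleₚ (- 1ℚ) q) → IsZeroₚ q
  scale-zero [] [] = []
  scale-zero (b ∷ q) (e ∷ z) = comb₁ (- 1ℚ) e (lem₂ b) ∷ scale-zero q z
  minus-zero : ∀ p q → IsZeroₚ (p +ₚ scaleₚ (- 1ℚ) q) → p ≈ₚ q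
  minus-zero [] q z = scale-zero q z
  minus-zero (a ∷ p) [] z = z
  minus-zero (a ∷ p) (b ∷ q) (e ∷ z) = comb₁ 1ℚ e (lem₃ a b) , minus-zero p q z

-- Degrees of sums, products, compositions and quotients.

-- All coefficients from index k on vanish: degree less than k, the zero polynomial included.
Below : Poly → ℕ → Set
Below [] k = ⊤
Below (a ∷ p) zero = IsZeroₚ (a ∷ p)
Below (a ∷ p) (suc k) = Below p k

zero-+ : ∀ {p q} → IsZeroₚ p → IsZeroₚ q → IsZeroₚ (p +ₚ q)
zero-+ [] zq = zq
zero-+ (e ∷ zp) [] = e ∷ zp
zero-+ (refl ∷ zp) (refl ∷ zq) = refl ∷ zero-+ zp zq

zero-scale : ∀ c {p} → IsZeroₚ p → IsZeroₚ (scaleₚ c p)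
zero-scale c [] = []
zero-scale c (refl ∷ z) = *-zeroʳ c ∷ zero-scale c z

zero-*ˡ : ∀ {p} q → IsZeroₚ p → IsZeroₚ (p *ₚ q)
zero-*ˡ q [] = []
zero-*ˡ q (refl ∷ z) = zero-+ (0-scale q) (refl ∷ zero-*ˡ q z)
  where
  0-scale : ∀ q → IsZeroₚ (scaleₚ 0ℚ q)
  0-scale [] = []
  0-scale (b ∷ q) = *-zeroˡ b ∷ 0-scale q

zero-*ʳ : ∀ p {q} → IsZeroₚ q → IsZeroₚ (p *ₚ q)
zero-*ʳ [] z = []
zero-*ʳ (a ∷ p) z = zero-+ (zero-scale a z) (refl ∷ zero-*ʳ p z)

zero-∘ : ∀ {p} h → IsZeroₚ p → IsZeroₚ (p ∘ₚ h)
zero-∘ h [] = []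
zero-∘ h (e ∷ z) = zero-+ (e ∷ []) (zero-*ʳ h (zero-∘ h z))

zero⇒below : ∀ {p} k → IsZeroₚ p → Below p k
zero⇒below k [] = tt
zero⇒below zero (e ∷ z) = e ∷ z
zero⇒below (suc k) (e ∷ z) = zero⇒below k z

degree-scale : ∀ {c} q n → c ≢ 0ℚ → HasDegree q n → HasDegree (scaleₚ c q) n
degree-scale {c} (b ∷ q) zero c≢0 (b≢0 , z) = (λ cb≡0 → b≢0 (*-cancel-0 c≢0 cb≡0)) , zero-scale c z
degree-scale (b ∷ q) (suc n) c≢0 d = degree-scale q n c≢0 d

below-scale : ∀ c q n k → HasDegree q n → n ℕ.< k → Below (scaleₚ c q) k
below-scale c (b ∷ q) zero (suc k) (_ , z) _ = zero⇒below k (zero-scale c z)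
below-scale c (b ∷ q) (suc n) (suc k) d (s≤s n<k) = below-scale c q n k d n<k

degree-+-below : ∀ p q k → Below p k → HasDegree q k → HasDegree (p +ₚ q) k
degree-+-below [] q k _ d = d
degree-+-below (a ∷ p) (b ∷ q) zero (refl ∷ zp) (b≢0 , zq) =
  (λ e → b≢0 (trans (sym (+-identityˡ b)) e)) , zero-+ zp zq
degree-+-below (a ∷ p) (b ∷ q) (suc k) l d = degree-+-below p q k l d

degree-+-zero : ∀ p q k → HasDegree p k → IsZeroₚ q → HasDegree (p +ₚ q) k
degree-+-zero (a ∷ p) [] k d _ = d
degree-+-zero (a ∷ p) (b ∷ q) zero (a≢0 , zp) (refl ∷ zq) =
  (λ e → a≢0 (trans (sym (+-identityʳ a)) e)) , zero-+ zp zq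
degree-+-zero (a ∷ p) (b ∷ q) (suc k) d (_ ∷ zq) = degree-+-zero p q k d zq

degree-* : ∀ p q m n → HasDegree p m → HasDegree q n → HasDegree (p *ₚ q) (m ℕ.+ n)
degree-* (a ∷ p) q zero n (a≢0 , z) dq =
  degree-+-zero (scaleₚ a q) _ n (degree-scale q n a≢0 dq) (refl ∷ zero-*ˡ q z)
degree-* (a ∷ p) q (suc m) n dp dq =
  degree-+-below (scaleₚ a q) _ (suc m ℕ.+ n)
    (below-scale a q n (suc m ℕ.+ n) dq (s≤s (ℕₚ.m≤n+m n m))) (degree-* p q m n dp dq)

degree-+-const : ∀ p c n → HasDegree p (suc n) → HasDegree (p +ₚ constₚ c) (suc n)
degree-+-const (a ∷ b ∷ p) c n d = d

-- Since `h` is non-constant, the constants added in the Horner scheme stay below the leading term.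
degree-∘ : ∀ p h m n → HasDegree p m → HasDegree h (suc n) → HasDegree (p ∘ₚ h) (m ℕ.* suc n)
degree-∘ (a ∷ p) h zero n (a≢0 , z) dh =
  degree-+-zero (constₚ a) _ 0 (a≢0 , []) (zero-*ʳ h (zero-∘ h z))
degree-∘ (a ∷ p) h (suc m) n dp dh =
  degree-+-below (constₚ a) (h *ₚ (p ∘ₚ h)) (suc m ℕ.* suc n) tt
    (degree-* h (p ∘ₚ h) (suc n) (m ℕ.* suc n) dh (degree-∘ p h m n dp dh))

zero-or-degree : ∀ p → IsZeroₚ p ⊎ Σ ℕ (HasDegree p)
zero-or-degree [] = inj₁ []
zero-or-degree (a ∷ p) with zero-or-degree p
... | inj₂ (n , d) = inj₂ (suc n , d)
... | inj₁ z with a ≟ 0ℚ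
...   | yes a≡0 = inj₁ (a≡0 ∷ z)
...   | no a≢0 = inj₂ (0 , a≢0 , z)

zero⇒¬degree : ∀ {p} n → IsZeroₚ p → ¬ HasDegree p n
zero⇒¬degree zero (e ∷ z) (a≢0 , _) = a≢0 e
zero⇒¬degree (suc n) (e ∷ z) d = zero⇒¬degree n z d

degree-unique : ∀ p m n → HasDegree p m → HasDegree p n → m ≡ n
degree-unique (a ∷ p) zero zero _ _ = refl
degree-unique (a ∷ p) zero (suc n) (_ , z) d = ⊥-elim (zero⇒¬degree n z d)
degree-unique (a ∷ p) (suc m) zero d (_ , z) = ⊥-elim (zero⇒¬degree m z d)
degree-unique (a ∷ p) (suc m) (suc n) d d′ = cong suc (degree-unique p m n d d′)

zero-≈ : ∀ p q → p ≈ₚ q → IsZeroₚ p → IsZeroₚ q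
zero-≈ [] q z _ = z
zero-≈ (a ∷ p) [] _ _ = []
zero-≈ (a ∷ p) (b ∷ q) (refl , e) (a≡0 ∷ z) = a≡0 ∷ zero-≈ p q e z

degree-≈ : ∀ p q n → p ≈ₚ q → HasDegree p n → HasDegree q n
degree-≈ (a ∷ p) [] n z d = ⊥-elim (zero⇒¬degree n z d)
degree-≈ (a ∷ p) (b ∷ q) zero (refl , e) (a≢0 , z) = a≢0 , zero-≈ p q e z
degree-≈ (a ∷ p) (b ∷ q) (suc n) (refl , e) d = degree-≈ p q n e d

degree-quotient : ∀ p g q m n → p ≈ₚ g *ₚ q → HasDegree p (m ℕ.+ n) → HasDegree g m → HasDegree q n
degree-quotient p g q m n p≈gq dp dg with zero-or-degree q
... | inj₁ z = ⊥-elim (zero⇒¬degree _ (zero-*ʳ g z) (degree-≈ p _ _ p≈gq dp))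
... | inj₂ (k , dq) = subst (HasDegree q) k≡n dq
  where
  k≡n : k ≡ n
  k≡n = ℕₚ.+-cancelˡ-≡ m k n (degree-unique (g *ₚ q) _ _ (degree-* g q m k dg dq) (degree-≈ p _ _ p≈gq dp))

-- Polynomial functions and cancellation by degree.

-- Quotients are given below by pointwise formulas; the stored coefficient list keeps degree
-- arguments available for them.
record PolyFun (φ : ℚ → ℚ) : Set where
  constructor _,_
  field
    poly : Poly
    eval-poly : ∀ x → ⟦ poly ⟧ x ≡ φ x

open PolyFun

polynomial : ∀ p → PolyFun ⟦ p ⟧
polynomial p = p , λ _ → refl

κ : ∀ c → PolyFun (λ _ → c)
κ c = constₚ c , eval-const c

infixl 6 _⊕_ _⊖_
infixl 7 _⊛_

_⊕_ : ∀ {φ ψ} → PolyFun φ → PolyFun ψ → PolyFun (λ x → φ x + ψ x)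
(p , P) ⊕ (q , Q) = p +ₚ q , λ x → trans (eval-+ p q x) (cong₂ _+_ (P x) (Q x))

_⊛_ : ∀ {φ ψ} → PolyFun φ → PolyFun ψ → PolyFun (λ x → φ x * ψ x)
(p , P) ⊛ (q , Q) = p *ₚ q , λ x → trans (eval-* p q x) (cong₂ _*_ (P x) (Q x))

_⊖_ : ∀ {φ ψ} → PolyFun φ → PolyFun ψ → PolyFun (λ x → φ x - ψ x)
_⊖_ {φ} {ψ} (p , P) (q , Q) = p +ₚ scaleₚ (- 1ℚ) q , λ x →
  trans (eval-+ p (scaleₚ (- 1ℚ) q) x)
    (trans (cong₂ _+_ (P x) (trans (eval-scale (- 1ℚ) q x) (cong (- 1ℚ *_) (Q x)))) (lem (φ x) (ψ x)))
  where
  lem : ∀ u v → u + - 1ℚ * v ≡ u - v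
  lem = solve-∀ ring

linear-poly : ∀ m n → PolyFun (λ x → n + x * m)
linear-poly m n = linₚ m n , lem m n
  where
  lem : ∀ m n x → n + x * (m + x * 0ℚ) ≡ n + x * m
  lem = solve-∀ ring

eval⇒∣ : ∀ {g p φ} → PolyFun φ → (∀ x → ⟦ p ⟧ x ≡ ⟦ g ⟧ x * φ x) → g ∣ₚ p
eval⇒∣ {g} {p} (q , Q) eq =
  q , eval⇒≈ p (g *ₚ q) λ x → trans (eq x) (sym (trans (eval-* g q x) (cong (⟦ g ⟧ x *_) (Q x))))

-- A non-zero cofactor of degree k would give the product degree n + k, but `r` has degree below n.
multiple-of-small-degree : ∀ e n r {φ} → HasDegree e n → Below r n → PolyFun φ →
                           (∀ x → ⟦ e ⟧ x * φ x ≡ ⟦ r ⟧ x) → (∀ x → φ x ≡ 0ℚ)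
multiple-of-small-degree e n r de dr (s , S) eq with zero-or-degree s
... | inj₁ z = λ x → trans (sym (S x)) (eval-zero z x)
... | inj₂ (k , ds) = ⊥-elim (¬below r n k dr
        (degree-≈ (e *ₚ s) r _ (eval⇒≈ _ r λ x → trans (eval-* e s x) (trans (cong (⟦ e ⟧ x *_) (S x)) (eq x)))
          (degree-* e s n k de ds)))
  where
  ¬below : ∀ r n k → Below r n → ¬ HasDegree r (n ℕ.+ k)
  ¬below (a ∷ r) zero k z d = zero⇒¬degree k z d
  ¬below (a ∷ r) (suc n) k l d = ¬below r n k l d

-- Pointwise division breaks down at roots of `e`, so the difference of the two cofactors is killed
-- by degree instead.
cancel : ∀ e n {φ ψ} → HasDegree e n → PolyFun φ → PolyFun ψ →
         (∀ x → ⟦ e ⟧ x * φ x ≡ ⟦ e ⟧ x * ψ x) → ∀ x → φ x ≡ ψ x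
cancel e n {φ} {ψ} de P Q eq x =
  x-y≡0⇒x≡y (multiple-of-small-degree e n [] de tt (P ⊖ Q) (λ y → comb₁ 1ℚ (eq y) (lem (⟦ e ⟧ y) (φ y) (ψ y))) x)
  where
  lem : ∀ e u v → e * (u - v) - 0ℚ ≡ 1ℚ * (e * u - e * v)
  lem = solve-∀ ring

linear-multiple : ∀ e u v {φ} → HasDegree e 2 → PolyFun φ →
                  (∀ x → ⟦ e ⟧ x * φ x ≡ v + x * u) → v ≡ 0ℚ × u ≡ 0ℚ
linear-multiple e u v {φ} de P eq = coefficients (eval⇒≈ (v ∷ u ∷ []) [] vanish)
  where
  r : Poly
  r = linₚ u v
  φ≡0 : ∀ x → φ x ≡ 0ℚ
  φ≡0 = multiple-of-small-degree e 2 r de tt P λ x → trans (eq x) (sym (eval-poly (linear-poly u v) x))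
  vanish : ∀ x → ⟦ r ⟧ x ≡ 0ℚ
  vanish x = trans (eval-poly (linear-poly u v) x) (trans (sym (eq x)) (trans (cong (⟦ e ⟧ x *_) (φ≡0 x)) (*-zeroʳ (⟦ e ⟧ x))))
  coefficients : IsZeroₚ (v ∷ u ∷ []) → v ≡ 0ℚ × u ≡ 0ℚ
  coefficients (v≡0 ∷ u≡0 ∷ []) = v≡0 , u≡0

-- Cube roots of -1 modulo a quadratic.

-- The leading coefficient `a₂` may vanish, so any function of degree at most two qualifies.
record Quadratic (a₀ a₁ a₂ : ℚ) (φ : ℚ → ℚ) : Set where
  constructor quadratic-form
  field
    value : ∀ x → φ x ≡ a₀ + x * (a₁ + x * a₂)

open Quadratic

quadratic : ∀ p → HasDegree p 2 → Σ ℚ λ a₀ → Σ ℚ λ a₁ → Σ ℚ λ a₂ → a₂ ≢ 0ℚ × Quadratic a₀ a₁ a₂ ⟦ p ⟧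
quadratic (a₀ ∷ a₁ ∷ a₂ ∷ p) (a₂≢0 , z) = a₀ , a₁ , a₂ , a₂≢0 , quadratic-form λ x →
  trans (cong (λ s → a₀ + x * (a₁ + x * (a₂ + x * s))) (eval-zero z x)) (lem a₀ a₁ a₂ x)
  where
  lem : ∀ a₀ a₁ a₂ x → a₀ + x * (a₁ + x * (a₂ + x * 0ℚ)) ≡ a₀ + x * (a₁ + x * a₂)
  lem = solve-∀ ring

-- Modulo e, the polynomial a is congruent to a linear t = n + m x with t³ ≡ -1.  If t is not
-- constant, it satisfies t² − T t + N ≡ 0 with trace T and norm N, and reducing t³ + 1 leaves
-- (T² − N) t + (1 − T N), which must vanish; so T³ = 1 and T = N = 1.
cube-root-mod : ∀ e {A φ} {e₀ e₁ e₂ a₀ a₁ a₂} → HasDegree e 2 → e₂ ≢ 0ℚ →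
  Quadratic e₀ e₁ e₂ ⟦ e ⟧ → Quadratic a₀ a₁ a₂ A → PolyFun A → PolyFun φ →
  (∀ x → A x * A x * A x + 1ℚ ≡ ⟦ e ⟧ x * φ x) →
  (Σ ℚ λ l → ∀ x → A x ≡ l * ⟦ e ⟧ x - 1ℚ) ⊎
  (Σ ℚ λ l → Σ ℚ λ m → Σ ℚ λ n → Σ ℚ λ μ → m ≢ 0ℚ ×
    (∀ x → A x ≡ l * ⟦ e ⟧ x + (n + x * m)) ×
    (∀ x → (n + x * m) * (n + x * m) - (n + x * m) + 1ℚ ≡ μ * ⟦ e ⟧ x))
cube-root-mod e {A} {φ} {e₀} {e₁} {e₂} {a₀} {a₁} {a₂} de e₂≢0 quadE quadA polyA polyφ A³+1≡Eφ
  = by-cases (m ≟ 0ℚ)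
  where
  k l m n T N : ℚ
  k = proj₁ (inverse e₂≢0)
  -- Division with remainder by `e`: `l` is the quotient and `n + x * m` the remainder of `A`.
  l = a₂ * k
  m = a₁ - l * e₁
  n = a₀ - l * e₀
  -- For the roots θ, θ′ of `e`, with θ + θ′ = -e₁ k and θ θ′ = e₀ k, these are the sum and the
  -- product of n + m θ and n + m θ′.
  T = n + n - m * e₁ * k
  N = m * m * e₀ * k - n * n + T * n
  E r ψ : ℚ → ℚ
  E = ⟦ e ⟧
  r x = n + x * m
  -- Since A - r = l E, the difference A³ - r³ equals l E (A² + A r + r²); subtracting it from A³ +
  -- 1 = E φ leaves r³ + 1 = E ψ.
  ψ x = φ x - l * (A x * A x + A x * r x + r x * r x)
  ke₂≡1 : k * e₂ ≡ 1ℚ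
  ke₂≡1 = proj₂ (inverse e₂≢0)
  polyr : PolyFun r
  polyr = linear-poly m n
  polyψ : PolyFun ψ
  polyψ = polyφ ⊖ κ l ⊛ (polyA ⊛ polyA ⊕ polyA ⊛ polyr ⊕ polyr ⊛ polyr)
  A≡lE+r : ∀ x → A x ≡ l * E x + r x
  A≡lE+r x = trans (value quadA x) (trans (comb₁ (- (a₂ * x * x)) ke₂≡1 (lem a₀ a₁ a₂ e₀ e₁ e₂ k x))
                    (cong (λ u → l * u + r x) (sym (value quadE x))))
    where
    lem : ∀ a₀ a₁ a₂ e₀ e₁ e₂ k x →
      a₀ + x * (a₁ + x * a₂)
        - (a₂ * k * (e₀ + x * (e₁ + x * e₂)) + (a₀ - a₂ * k * e₀ + x * (a₁ - a₂ * k * e₁)))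
      ≡ - (a₂ * x * x) * (k * e₂ - 1ℚ)
    lem = solve-∀ ring
  Eψ≡r³+1 : ∀ x → E x * ψ x ≡ r x * r x * r x + 1ℚ
  Eψ≡r³+1 x = comb₂ (- 1ℚ) (A³+1≡Eφ x) (A x * A x + A x * r x + r x * r x) (A≡lE+r x)
                (lem (E x) (φ x) (A x) (r x) l)
    where
    lem : ∀ e p a r l →
      e * (p - l * (a * a + a * r + r * r)) - (r * r * r + 1ℚ)
      ≡ - 1ℚ * (a * a * a + 1ℚ - e * p) + (a * a + a * r + r * r) * (a - (l * e + r))
    lem = solve-∀ ring
  char-poly : ∀ x → r x * r x - T * r x + N ≡ m * m * k * E x
  char-poly x = trans (comb₁ (- (m * m * x * x)) ke₂≡1 (lem m n e₀ e₁ e₂ k x))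
                  (cong (m * m * k *_) (sym (value quadE x)))
    where
    lem : ∀ m n e₀ e₁ e₂ k x →
      (n + x * m) * (n + x * m) - (n + n - m * e₁ * k) * (n + x * m)
        + (m * m * e₀ * k - n * n + (n + n - m * e₁ * k) * n)
        - m * m * k * (e₀ + x * (e₁ + x * e₂))
      ≡ - (m * m * x * x) * (k * e₂ - 1ℚ)
    lem = solve-∀ ring

  constant-case : m ≡ 0ℚ → ∀ x → A x ≡ l * E x - 1ℚ
  constant-case m≡0 x = trans (A≡lE+r x) (cong (λ u → l * E x + u) r≡-1)
    where
    lem₁ : ∀ n m x → (n + x * m) * (n + x * m) * (n + x * m) + 1ℚ - (n * n * n + 1ℚ + x * 0ℚ)
                   ≡ x * ((n + x * m) * (n + x * m) + (n + x * m) * n + n * n) * (m - 0ℚ)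
    lem₁ = solve-∀ ring
    -- For m = 0 the multiple r³ + 1 of `e` is the constant n³ + 1, so it is zero.
    n³+1≡0 : n * n * n + 1ℚ ≡ 0ℚ
    n³+1≡0 = proj₁ (linear-multiple e 0ℚ _ de polyψ λ y →
      trans (Eψ≡r³+1 y) (comb₁ (y * (r y * r y + r y * n + n * n)) m≡0 (lem₁ n m y)))
    lem₂ : ∀ n → (- n) * (- n) * (- n) - 1ℚ ≡ - 1ℚ * (n * n * n + 1ℚ - 0ℚ)
    lem₂ = solve-∀ ring
    -n≡1 : - n ≡ 1ℚ
    -n≡1 = x³≡1⇒x≡1 (- n) (comb₁ (- 1ℚ) n³+1≡0 (lem₂ n))
    lem₃ : ∀ n m x → n + x * m - - 1ℚ ≡ - 1ℚ * (- n - 1ℚ) + x * (m - 0ℚ)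
    lem₃ = solve-∀ ring
    r≡-1 : r x ≡ - 1ℚ
    r≡-1 = comb₂ (- 1ℚ) -n≡1 x m≡0 (lem₃ n m x)

  nonconstant-case : m ≢ 0ℚ → ∀ x → r x * r x - r x + 1ℚ ≡ m * m * k * E x
  nonconstant-case m≢0 x = trans (comb₂ (r x) T≡1 (- 1ℚ) N≡1 (lem₄ (r x) T N)) (char-poly x)
    where
    both : (T * T - N) * n + (1ℚ - T * N) ≡ 0ℚ × (T * T - N) * m ≡ 0ℚ
    -- Dividing r³ + 1 by r² - T r + N gives the quotient r + T and the remainder (T² - N) r + (1 -
    -- T N), a multiple of `e` of degree at most one in x.
    both = linear-multiple e _ _ de (polyψ ⊖ (polyr ⊕ κ T) ⊛ κ (m * m * k)) λ y →
      comb₂ 1ℚ (Eψ≡r³+1 y) (r y + T) (char-poly y) (lem₁ (E y) (ψ y) T N (m * m * k) m n y)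
      where
      lem₁ : ∀ e p T N c m n x →
        e * (p - (n + x * m + T) * c) - ((T * T - N) * n + (1ℚ - T * N) + x * ((T * T - N) * m))
         ≡ 1ℚ * (e * p - ((n + x * m) * (n + x * m) * (n + x * m) + 1ℚ))
           + (n + x * m + T) * ((n + x * m) * (n + x * m) - T * (n + x * m) + N - c * e)
      lem₁ = solve-∀ ring
    T²-N≡0 : T * T - N ≡ 0ℚ
    T²-N≡0 = *-cancel-0 m≢0 (trans (*-comm m (T * T - N)) (proj₂ both))
    lem₂ : ∀ T N n → T * T * T - 1ℚ ≡ - 1ℚ * ((T * T - N) * n + (1ℚ - T * N) - 0ℚ) + (n + T) * (T * T - N - 0ℚ)
    lem₂ = solve-∀ ring
    T≡1 : T ≡ 1ℚ
    T≡1 = x³≡1⇒x≡1 T (comb₂ (- 1ℚ) (proj₁ both) (n + T) T²-N≡0 (lem₂ T N n))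
    lem₃ : ∀ T N → N - 1ℚ ≡ - 1ℚ * (T * T - N - 0ℚ) + (T + 1ℚ) * (T - 1ℚ)
    lem₃ = solve-∀ ring
    N≡1 : N ≡ 1ℚ
    N≡1 = comb₂ (- 1ℚ) T²-N≡0 (T + 1ℚ) T≡1 (lem₃ T N)
    lem₄ : ∀ r T N → r * r - r + 1ℚ - (r * r - T * r + N) ≡ r * (T - 1ℚ) + - 1ℚ * (N - 1ℚ)
    lem₄ = solve-∀ ring

  by-cases : Dec (m ≡ 0ℚ) → _
  by-cases (yes m≡0) = inj₁ (l , constant-case m≡0)
  by-cases (no m≢0) = inj₂ (l , m , n , m * m * k , m≢0 , A≡lE+r , nonconstant-case m≢0)

-- Trivial pairs, and the values of F and G.

-- The common inner polynomial is `f` itself, with outer polynomials t and `w`.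
polynomial-in-f⇒trivial : ∀ f g w → HasDegree f 2 → (∀ x → ⟦ g ⟧ x ≡ ⟦ w ⟧ (⟦ f ⟧ x)) → Trivial f g
polynomial-in-f⇒trivial f g w df eq = 0ℚ ∷ 1ℚ ∷ [] , w , f , (2 , ℕₚ.≤-refl , df) ,
  eval⇒≈ f _ (λ x → trans (lem (⟦ f ⟧ x)) (sym (eval-∘ (0ℚ ∷ 1ℚ ∷ []) f x))) ,
  eval⇒≈ g _ (λ x → trans (eq x) (sym (eval-∘ w f x)))
  where
  lem : ∀ y → y ≡ 0ℚ + y * (1ℚ + y * 0ℚ)
  lem = solve-∀ ring

eval-F : ∀ x → ⟦ Fₚ ⟧ x ≡ ½ * (x * x - x + 1ℚ)
eval-F x = trans (eval-scale ½ (1ℚ ∷ - 1ℚ ∷ 1ℚ ∷ []) x) (cong (½ *_) (lem x))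
  where
  lem : ∀ x → 1ℚ + x * (- 1ℚ + x * (1ℚ + x * 0ℚ)) ≡ x * x - x + 1ℚ
  lem = solve-∀ ring

-- As F + 1 = ½ (t² - t + 3), this displays G in the shape (f + 1) q used in both directions.
eval-G : ∀ x → ⟦ Gₚ ⟧ x ≡ (½ * (x * x - x + 1ℚ) + 1ℚ) * (½ * (x * x + x + 1ℚ))
eval-G x = trans (eval-scale (+ 1 / 4) (u *ₚ v) x) (trans (cong ((+ 1 / 4) *_) (eval-* u v x)) (lem x))
  where
  u v : Poly
  u = 1ℚ ∷ 1ℚ ∷ 1ℚ ∷ []
  v = (+ 3 / 1) ∷ - 1ℚ ∷ 1ℚ ∷ []
  lem : ∀ x → (+ 1 / 4) * ((1ℚ + x * (1ℚ + x * (1ℚ + x * 0ℚ))) * ((+ 3 / 1) + x * (- 1ℚ + x * (1ℚ + x * 0ℚ))))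
            ≡ (½ * (x * x - x + 1ℚ) + 1ℚ) * (½ * (x * x + x + 1ℚ))
  lem = solve-∀ ring

Reparametrisation : Poly → Poly → Set
Reparametrisation f g = Σ ℚ λ α → Σ ℚ λ β → (α ≢ 0ℚ) × (f ≈ₚ Fₚ ∘ₚ linₚ α β) × (g ≈ₚ Gₚ ∘ₚ linₚ α β)

eval-lin : ∀ α β x → ⟦ linₚ α β ⟧ x ≡ β + x * α
eval-lin α β = eval-poly (linear-poly α β)

eval-F∘lin : ∀ α β x → ⟦ Fₚ ∘ₚ linₚ α β ⟧ x ≡ ⟦ Fₚ ⟧ (β + x * α)
eval-F∘lin α β x = trans (eval-∘ Fₚ (linₚ α β) x) (cong ⟦ Fₚ ⟧ (eval-lin α β x))

eval-G∘lin : ∀ α β x → ⟦ Gₚ ∘ₚ linₚ α β ⟧ x ≡ ⟦ Gₚ ⟧ (β + x * α)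
eval-G∘lin α β x = trans (eval-∘ Gₚ (linₚ α β) x) (cong ⟦ Gₚ ⟧ (eval-lin α β x))

-- From non-trivial solutions to F and G.

-- In the coordinate t the factorisation of f² − f + 1 reads
-- (e₀ + e₁ t + e₂ t²)(ℓ t² + (1 − ℓ) t + ℓ) with f = ν (t² − t + 1) and ℓ = l ν.
-- The coefficients of degree 4, 0 and 3, 1 give e₀ − e₂ = 1 and ℓ = 1 − ν; eliminating
-- e₁ and e₂ from the remaining ones collapses to 2 ν = 1.
coefficients-determined : ∀ ν ℓ e₀ e₁ e₂ →
  (∀ t → ν * (t * t - t + 1ℚ) * (ν * (t * t - t + 1ℚ)) - ν * (t * t - t + 1ℚ) + 1ℚ
         ≡ (e₀ + t * (e₁ + t * e₂)) * (ℓ * (t * t - t + 1ℚ) + t)) →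
  ν ≡ ½ × ℓ ≡ ½
coefficients-determined ν ℓ e₀ e₁ e₂ eq = solve-coefficients (eval⇒≈ lhs rhs λ t →
    trans (lem-l ν t) (trans (eq t) (lem-r ℓ e₀ e₁ e₂ t)))
  where
  lhs rhs : Poly
  lhs = (ν * ν - ν + 1ℚ) ∷ (ν - (ν * ν + ν * ν)) ∷ (ν * ν + ν * ν + ν * ν - ν) ∷ - (ν * ν + ν * ν) ∷ ν * ν ∷ []
  rhs = ℓ * e₀ ∷ ((1ℚ - ℓ) * e₀ + ℓ * e₁) ∷ (ℓ * e₀ + (1ℚ - ℓ) * e₁ + ℓ * e₂) ∷ (ℓ * e₁ + (1ℚ - ℓ) * e₂) ∷ ℓ * e₂ ∷ []
  lem-l : ∀ ν t →
    (ν * ν - ν + 1ℚ) + t * ((ν - (ν * ν + ν * ν)) + t * ((ν * ν + ν * ν + ν * ν - ν)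
      + t * (- (ν * ν + ν * ν) + t * (ν * ν + t * 0ℚ))))
    ≡ ν * (t * t - t + 1ℚ) * (ν * (t * t - t + 1ℚ)) - ν * (t * t - t + 1ℚ) + 1ℚ
  lem-l = solve-∀ ring
  lem-r : ∀ ℓ e₀ e₁ e₂ t →
    (e₀ + t * (e₁ + t * e₂)) * (ℓ * (t * t - t + 1ℚ) + t)
    ≡ ℓ * e₀ + t * (((1ℚ - ℓ) * e₀ + ℓ * e₁) + t * ((ℓ * e₀ + (1ℚ - ℓ) * e₁ + ℓ * e₂)
      + t * ((ℓ * e₁ + (1ℚ - ℓ) * e₂) + t * (ℓ * e₂ + t * 0ℚ))))
  lem-r = solve-∀ ring
  solve-coefficients : lhs ≈ₚ rhs → ν ≡ ½ × ℓ ≡ ½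
  solve-coefficients (c₀ , c₁ , c₂ , c₃ , c₄ , _) = ν≡½ , comb₂ 1ℚ ℓ≡1-ν (- 1ℚ) ν≡½ (lem₆ ν ℓ)
    where
    lem₁ : ∀ ν ℓ e₀ e₁ e₂ → e₀ - e₂ - 1ℚ
      ≡ - 1ℚ * (ν * ν - ν + 1ℚ + (ν - (ν * ν + ν * ν)) - (ℓ * e₀ + ((1ℚ - ℓ) * e₀ + ℓ * e₁)))
        + 1ℚ * (- (ν * ν + ν * ν) + ν * ν - (ℓ * e₁ + (1ℚ - ℓ) * e₂ + ℓ * e₂))
    lem₁ = solve-∀ ring
    e₀-e₂≡1 : e₀ - e₂ ≡ 1ℚ
    -- The two lowest coefficients sum to 1 - ν² = e₀ + ℓ e₁, the two highest to -ν² = e₂ + ℓ e₁.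
    e₀-e₂≡1 = comb₂ (- 1ℚ) (cong₂ _+_ c₀ c₁) 1ℚ (cong₂ _+_ c₃ c₄) (lem₁ ν ℓ e₀ e₁ e₂)
    lem₂ : ∀ ν ℓ e₀ e₂ → ℓ - (1ℚ - ν)
      ≡ - 1ℚ * (ν * ν - ν + 1ℚ - ν * ν - (ℓ * e₀ - ℓ * e₂)) + - ℓ * (e₀ - e₂ - 1ℚ)
    lem₂ = solve-∀ ring
    ℓ≡1-ν : ℓ ≡ 1ℚ - ν
    ℓ≡1-ν = comb₂ (- 1ℚ) (cong₂ _-_ c₀ c₄) (- ℓ) e₀-e₂≡1 (lem₂ ν ℓ e₀ e₂)
    lem₃ : ∀ ν ℓ e₀ e₁ e₂ → (1ℚ - ℓ) * e₁ - (ν * ν - 1ℚ)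
      ≡ - 1ℚ * (ν * ν + ν * ν + ν * ν - ν - (ℓ * e₀ + (1ℚ - ℓ) * e₁ + ℓ * e₂))
        + 1ℚ * (ν * ν - ν + 1ℚ + ν * ν - (ℓ * e₀ + ℓ * e₂))
    lem₃ = solve-∀ ring
    [1-ℓ]e₁≡ν²-1 : (1ℚ - ℓ) * e₁ ≡ ν * ν - 1ℚ
    [1-ℓ]e₁≡ν²-1 = comb₂ (- 1ℚ) c₂ 1ℚ (cong₂ _+_ c₀ c₄) (lem₃ ν ℓ e₀ e₁ e₂)
    lem₄ : ∀ ν ℓ e₁ e₂ →
      - (ν * ν + ν * ν) * (ℓ * (1ℚ - ℓ)) - (ℓ * ℓ * (ν * ν - 1ℚ) + (1ℚ - ℓ) * (1ℚ - ℓ) * (ν * ν))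
      ≡ ℓ * (1ℚ - ℓ) * (- (ν * ν + ν * ν) - (ℓ * e₁ + (1ℚ - ℓ) * e₂))
        + ℓ * ℓ * ((1ℚ - ℓ) * e₁ - (ν * ν - 1ℚ)) + - ((1ℚ - ℓ) * (1ℚ - ℓ)) * (ν * ν - ℓ * e₂)
    lem₄ = solve-∀ ring
    elimination : - (ν * ν + ν * ν) * (ℓ * (1ℚ - ℓ)) ≡ ℓ * ℓ * (ν * ν - 1ℚ) + (1ℚ - ℓ) * (1ℚ - ℓ) * (ν * ν)
    -- Multiplying the cubic coefficient by ℓ (1 - ℓ) makes `e₁` and `e₂` occur only as (1 - ℓ) e₁
    -- and ℓ e₂, both known in terms of ν.
    elimination = comb₃ (ℓ * (1ℚ - ℓ)) c₃ (ℓ * ℓ) [1-ℓ]e₁≡ν²-1 (- ((1ℚ - ℓ) * (1ℚ - ℓ))) c₄ (lem₄ ν ℓ e₁ e₂)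
    lem₅ : ∀ ν → ν - ½
      ≡ - ½ * (- (ν * ν + ν * ν) * ((1ℚ - ν) * (1ℚ - (1ℚ - ν)))
               - ((1ℚ - ν) * (1ℚ - ν) * (ν * ν - 1ℚ) + (1ℚ - (1ℚ - ν)) * (1ℚ - (1ℚ - ν)) * (ν * ν)))
    lem₅ = solve-∀ ring
    ν≡½ : ν ≡ ½
    -- With ℓ = 1 - ν both sides share their terms of degree two and higher in ν, and their
    -- difference is 1 - 2 ν.
    ν≡½ = comb₁ (- ½)
      (subst (λ ℓ → - (ν * ν + ν * ν) * (ℓ * (1ℚ - ℓ)) ≡ ℓ * ℓ * (ν * ν - 1ℚ) + (1ℚ - ℓ) * (1ℚ - ℓ) * (ν * ν))
        ℓ≡1-ν elimination)
      (lem₅ ν)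
    lem₆ : ∀ ν ℓ → ℓ - ½ ≡ 1ℚ * (ℓ - (1ℚ - ν)) + - 1ℚ * (ν - ½)
    lem₆ = solve-∀ ring

solution-in-t : ∀ f g e {q : ℚ → ℚ} {e₀ e₁ e₂} l m n μ → Quadratic e₀ e₁ e₂ ⟦ e ⟧ → m ≢ 0ℚ →
  (∀ x → ⟦ g ⟧ x ≡ (⟦ f ⟧ x + 1ℚ) * q x) →
  (∀ x → ⟦ f ⟧ x * ⟦ f ⟧ x - ⟦ f ⟧ x + 1ℚ ≡ ⟦ e ⟧ x * q x) →
  (∀ x → q x ≡ l * ⟦ f ⟧ x + (n + x * m)) →
  (∀ x → (n + x * m) * (n + x * m) - (n + x * m) + 1ℚ ≡ μ * ⟦ f ⟧ x) →
  Reparametrisation f g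
solution-in-t f g e {q} {e₀} {e₁} {e₂} l m n μ quadE m≢0 g≡[f+1]q f²-f+1≡eq q≡lf+t t²-t+1≡μf =
  m , n , m≢0 ,
  eval⇒≈ f _ (λ x → trans (f≡F x) (sym (trans (eval-F∘lin m n x) (eval-F (t x))))) ,
  eval⇒≈ g _ (λ x → trans (g≡G x) (sym (trans (eval-G∘lin m n x) (eval-G (t x)))))
  where
  t : ℚ → ℚ
  t x = n + x * m
  μ≢0 : μ ≢ 0ℚ
  -- t² - t + 1 has no rational zero, so any sample point refutes μ = 0.
  μ≢0 μ≡0 = x²-x+1≢0 (t 0ℚ)
    (trans (t²-t+1≡μf 0ℚ) (trans (cong (_* ⟦ f ⟧ 0ℚ) μ≡0) (*-zeroˡ (⟦ f ⟧ 0ℚ))))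
  ν k : ℚ
  ν = proj₁ (inverse μ≢0)
  k = proj₁ (inverse m≢0)
  f≡ν : ∀ x → ⟦ f ⟧ x ≡ ν * (t x * t x - t x + 1ℚ)
  f≡ν x = comb₂ (- ⟦ f ⟧ x) (proj₂ (inverse μ≢0)) (- ν) (t²-t+1≡μf x) (lem (⟦ f ⟧ x) ν μ (t x))
    where
    lem : ∀ f ν μ t → f - ν * (t * t - t + 1ℚ) ≡ - f * (ν * μ - 1ℚ) + - ν * (t * t - t + 1ℚ - μ * f)
    lem = solve-∀ ring
  q≡ν : ∀ x → q x ≡ l * ν * (t x * t x - t x + 1ℚ) + t x
  q≡ν x = comb₂ 1ℚ (q≡lf+t x) l (f≡ν x) (lem (q x) l (⟦ f ⟧ x) ν (t x))
    where
    lem : ∀ q l f ν t → q - (l * ν * (t * t - t + 1ℚ) + t)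
        ≡ 1ℚ * (q - (l * f + t)) + l * (f - ν * (t * t - t + 1ℚ))
    lem = solve-∀ ring
  E₀ E₁ E₂ : ℚ
  -- Coefficients of `e` in the coordinate y = t(x), by substituting the inverse map x = k (y - n).
  E₀ = e₀ - e₁ * k * n + e₂ * k * k * n * n
  E₁ = e₁ * k - (e₂ * k * k * n + e₂ * k * k * n)
  E₂ = e₂ * k * k
  x[_] : ℚ → ℚ
  x[ y ] = k * (y - n)
  t-x : ∀ y → t x[ y ] ≡ y
  t-x y = comb₁ (y - n) (proj₂ (inverse m≢0)) (lem k m n y)
    where
    lem : ∀ k m n y → n + k * (y - n) * m - y ≡ (y - n) * (k * m - 1ℚ)
    lem = solve-∀ ring
  e≡E : ∀ y → ⟦ e ⟧ x[ y ] ≡ E₀ + y * (E₁ + y * E₂)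
  e≡E y = trans (value quadE x[ y ]) (lem e₀ e₁ e₂ k n y)
    where
    lem : ∀ e₀ e₁ e₂ k n y → e₀ + k * (y - n) * (e₁ + k * (y - n) * e₂)
        ≡ e₀ - e₁ * k * n + e₂ * k * k * n * n
          + y * (e₁ * k - (e₂ * k * k * n + e₂ * k * k * n) + y * (e₂ * k * k))
    lem = solve-∀ ring
  f-at : ∀ y → ⟦ f ⟧ x[ y ] ≡ ν * (y * y - y + 1ℚ)
  f-at y = trans (f≡ν x[ y ]) (cong (λ s → ν * (s * s - s + 1ℚ)) (t-x y))
  q-at : ∀ y → q x[ y ] ≡ l * ν * (y * y - y + 1ℚ) + y
  q-at y = trans (q≡ν x[ y ]) (cong (λ s → l * ν * (s * s - s + 1ℚ) + s) (t-x y))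
  determined : ν ≡ ½ × l * ν ≡ ½
  determined = coefficients-determined ν (l * ν) E₀ E₁ E₂ λ y →
    trans (cong (λ s → s * s - s + 1ℚ) (sym (f-at y)))
      (trans (f²-f+1≡eq x[ y ]) (cong₂ _*_ (e≡E y) (q-at y)))
  f≡F : ∀ x → ⟦ f ⟧ x ≡ ½ * (t x * t x - t x + 1ℚ)
  f≡F x = trans (f≡ν x) (cong (_* (t x * t x - t x + 1ℚ)) (proj₁ determined))
  g≡G : ∀ x → ⟦ g ⟧ x ≡ (½ * (t x * t x - t x + 1ℚ) + 1ℚ) * (½ * (t x * t x + t x + 1ℚ))
  g≡G x = trans (g≡[f+1]q x) (cong₂ (λ u v → (u + 1ℚ) * v) (f≡F x)
    (trans (q≡ν x) (trans (cong (λ c → c * (t x * t x - t x + 1ℚ) + t x) (proj₂ determined)) (lem (t x)))))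
    where
    lem : ∀ t → ½ * (t * t - t + 1ℚ) + t ≡ ½ * (t * t + t + 1ℚ)
    lem = solve-∀ ring

second-divisibility : ∀ f g e {q e₀ e₁ e₂ q₀ q₁ q₂} → HasDegree f 2 → ¬ Trivial f g →
  Quadratic e₀ e₁ e₂ ⟦ e ⟧ → Quadratic q₀ q₁ q₂ q → PolyFun q →
  (∀ x → ⟦ g ⟧ x ≡ (⟦ f ⟧ x + 1ℚ) * q x) →
  (∀ x → ⟦ f ⟧ x * ⟦ f ⟧ x - ⟦ f ⟧ x + 1ℚ ≡ ⟦ e ⟧ x * q x) →
  f ∣ₚ cubeₚ g +ₚ constₚ 1ℚ → Reparametrisation f g
second-divisibility f g e {q} df nontrivial quadE quadq polyq g≡[f+1]q f²-f+1≡eq (c , g³+1≈fc) =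
  by-cases (quadratic f df)
  where
  φ : ℚ → ℚ
  -- From (f + 1)³ = 1 + f (f² + 3 f + 3): g³ and q³ differ by f q³ (f² + 3 f + 3).
  φ x = ⟦ c ⟧ x - q x * q x * q x * (⟦ f ⟧ x * ⟦ f ⟧ x + (+ 3 / 1) * ⟦ f ⟧ x + (+ 3 / 1))
  polyφ : PolyFun φ
  polyφ = polynomial c ⊖ polyq ⊛ polyq ⊛ polyq ⊛ (polynomial f ⊛ polynomial f ⊕ κ (+ 3 / 1) ⊛ polynomial f ⊕ κ (+ 3 / 1))
  g³+1≡fc : ∀ x → ⟦ g ⟧ x * ⟦ g ⟧ x * ⟦ g ⟧ x + 1ℚ ≡ ⟦ f ⟧ x * ⟦ c ⟧ x
  g³+1≡fc x = trans (sym (eval-cube+1 g x))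
    (trans (≈⇒eval (cubeₚ g +ₚ constₚ 1ℚ) (f *ₚ c) g³+1≈fc x) (eval-* f c x))
  q³+1≡fφ : ∀ x → q x * q x * q x + 1ℚ ≡ ⟦ f ⟧ x * φ x
  q³+1≡fφ x = comb₁ 1ℚ (trans (cong (λ s → s * s * s + 1ℚ) (sym (g≡[f+1]q x))) (g³+1≡fc x))
                (lem (q x) (⟦ f ⟧ x) (⟦ c ⟧ x))
    where
    lem : ∀ q f c → q * q * q + 1ℚ - f * (c - q * q * q * (f * f + (+ 3 / 1) * f + (+ 3 / 1)))
        ≡ 1ℚ * ((f + 1ℚ) * q * ((f + 1ℚ) * q) * ((f + 1ℚ) * q) + 1ℚ - f * c)
    lem = solve-∀ ring
  conclude : _ → Reparametrisation f g
  conclude (inj₁ (l , q≡lf-1)) = ⊥-elim (nontrivial (polynomial-in-f⇒trivial f g (- 1ℚ ∷ (l - 1ℚ) ∷ l ∷ []) df λ x →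
      trans (g≡[f+1]q x) (trans (cong ((⟦ f ⟧ x + 1ℚ) *_) (q≡lf-1 x)) (lem l (⟦ f ⟧ x)))))
    where
    lem : ∀ l f → (f + 1ℚ) * (l * f - 1ℚ) ≡ - 1ℚ + f * (l - 1ℚ + f * (l + f * 0ℚ))
    lem = solve-∀ ring
  conclude (inj₂ (l , m , n , μ , m≢0 , q≡lf+t , t²-t+1≡μf)) =
    solution-in-t f g e {q} l m n μ quadE m≢0 g≡[f+1]q f²-f+1≡eq q≡lf+t t²-t+1≡μf
  by-cases : _ → Reparametrisation f g
  by-cases (a₀ , a₁ , a₂ , a₂≢0 , quadf) = conclude (cube-root-mod f df a₂≢0 quadf quadq polyq polyφ q³+1≡fφ)

solution⇒reparametrisation : ∀ f g → HasDegree f 2 → HasDegree g 4 → IsSolution f g → ¬ Trivial f g → Reparametrisation f g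
solution⇒reparametrisation f g df dg ((e , f³+1≈ge) , f∣g³+1) nontrivial = by-cases (quadratic e de) (quadratic f df)
  where
  de : HasDegree e 2
  de = degree-quotient (cubeₚ f +ₚ constₚ 1ℚ) g e 4 2 f³+1≈ge
         (degree-+-const (cubeₚ f) 1ℚ 5 (degree-* (f *ₚ f) f 4 2 (degree-* f f 2 2 df df) df)) dg
  f³+1≡eg : ∀ x → ⟦ f ⟧ x * ⟦ f ⟧ x * ⟦ f ⟧ x + 1ℚ ≡ ⟦ e ⟧ x * ⟦ g ⟧ x
  f³+1≡eg x = trans (sym (eval-cube+1 f x))
    (trans (≈⇒eval (cubeₚ f +ₚ constₚ 1ℚ) (g *ₚ e) f³+1≈ge x)
      (trans (eval-* g e x) (*-comm (⟦ g ⟧ x) (⟦ e ⟧ x))))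
  by-cases : _ → _ → Reparametrisation f g
  by-cases (e₀ , e₁ , e₂ , e₂≢0 , quadE) (a₀ , a₁ , a₂ , _ , quadf) =
    conclude (cube-root-mod e de e₂≢0 quadE quadf (polynomial f) (polynomial g) f³+1≡eg)
    where
    conclude : _ → Reparametrisation f g
    -- Here f + 1 = l e, so cancelling `e` in e g = (f + 1)(f² - f + 1) leaves g = l (f² - f + 1).
    conclude (inj₁ (l , f≡le-1)) =
      ⊥-elim (nontrivial (polynomial-in-f⇒trivial f g (l ∷ - l ∷ l ∷ []) df λ x →
        trans (cancel e 2 de (polynomial g) (κ l ⊛ (polynomial f ⊛ polynomial f ⊖ polynomial f ⊕ κ 1ℚ))
                (λ y → comb₂ (- 1ℚ) (f³+1≡eg y) (⟦ f ⟧ y * ⟦ f ⟧ y - ⟦ f ⟧ y + 1ℚ) (f≡le-1 y)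
                         (lem₁ (⟦ e ⟧ y) (⟦ g ⟧ y) l (⟦ f ⟧ y))) x)
              (lem₂ l (⟦ f ⟧ x))))
      where
      lem₁ : ∀ e g l f → e * g - e * (l * (f * f - f + 1ℚ))
           ≡ - 1ℚ * (f * f * f + 1ℚ - e * g) + (f * f - f + 1ℚ) * (f - (l * e - 1ℚ))
      lem₁ = solve-∀ ring
      lem₂ : ∀ l f → l * (f * f - f + 1ℚ) ≡ l + f * (- l + f * (l + f * 0ℚ))
      lem₂ = solve-∀ ring
    conclude (inj₂ (l , m , n , μ , _ , f≡le+r , r²-r+1≡μe)) =
      second-divisibility f g e df nontrivial quadE quadq polyq g≡[f+1]q f²-f+1≡eq f∣g³+1
      where
      q : ℚ → ℚ
      -- With r = n + m x, f² - f + 1 = (f - r)(f + r - 1) + (r² - r + 1), where f - r = l e and f +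
      -- r = l e + 2 r; dividing by `e` gives this cofactor.
      q x = l * (l * ⟦ e ⟧ x + ((n + x * m) + (n + x * m)) - 1ℚ) + μ
      polyq : PolyFun q
      polyq = κ l ⊛ (κ l ⊛ polynomial e ⊕ (linear-poly m n ⊕ linear-poly m n) ⊖ κ 1ℚ) ⊕ κ μ
      quadq : Quadratic (l * (l * e₀ + (n + n) - 1ℚ) + μ) (l * (l * e₁ + (m + m))) (l * (l * e₂)) q
      quadq = quadratic-form λ x → trans (cong (λ s → l * (l * s + ((n + x * m) + (n + x * m)) - 1ℚ) + μ) (value quadE x))
                  (lem l m n μ e₀ e₁ e₂ x)
        where
        lem : ∀ l m n μ e₀ e₁ e₂ x →
          l * (l * (e₀ + x * (e₁ + x * e₂)) + ((n + x * m) + (n + x * m)) - 1ℚ) + μ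
          ≡ l * (l * e₀ + (n + n) - 1ℚ) + μ + x * (l * (l * e₁ + (m + m)) + x * (l * (l * e₂)))
        lem = solve-∀ ring
      f²-f+1≡eq : ∀ x → ⟦ f ⟧ x * ⟦ f ⟧ x - ⟦ f ⟧ x + 1ℚ ≡ ⟦ e ⟧ x * q x
      f²-f+1≡eq x = comb₂ (⟦ f ⟧ x + l * ⟦ e ⟧ x + (n + x * m) - 1ℚ) (f≡le+r x) 1ℚ (r²-r+1≡μe x)
                      (lem (⟦ f ⟧ x) (⟦ e ⟧ x) l m n μ x)
        where
        lem : ∀ f e l m n μ x →
          f * f - f + 1ℚ - e * (l * (l * e + ((n + x * m) + (n + x * m)) - 1ℚ) + μ)
          ≡ (f + l * e + (n + x * m) - 1ℚ) * (f - (l * e + (n + x * m)))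
            + 1ℚ * ((n + x * m) * (n + x * m) - (n + x * m) + 1ℚ - μ * e)
        lem = solve-∀ ring
      g≡[f+1]q : ∀ x → ⟦ g ⟧ x ≡ (⟦ f ⟧ x + 1ℚ) * q x
      g≡[f+1]q = cancel e 2 de (polynomial g) ((polynomial f ⊕ κ 1ℚ) ⊛ polyq) λ x →
        comb₂ (- 1ℚ) (f³+1≡eg x) (⟦ f ⟧ x + 1ℚ) (f²-f+1≡eq x) (lem (⟦ e ⟧ x) (⟦ g ⟧ x) (⟦ f ⟧ x) (q x))
        where
        lem : ∀ e g f q → e * g - e * ((f + 1ℚ) * q)
            ≡ - 1ℚ * (f * f * f + 1ℚ - e * g) + (f + 1ℚ) * (f * f - f + 1ℚ - e * q)
        lem = solve-∀ ring

-- The converse: F and G give a non-trivial solution.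

reparametrisation⇒solution : ∀ f g → Reparametrisation f g → IsSolution f g
reparametrisation⇒solution f g (α , β , _ , f≈F , g≈G) = eval⇒∣ {g} p₁ first , eval⇒∣ {f} p₂ second
  where
  t q : ℚ → ℚ
  t x = β + x * α
  q x = ½ * (t x * t x + t x + 1ℚ)
  f≡F : ∀ x → ⟦ f ⟧ x ≡ ½ * (t x * t x - t x + 1ℚ)
  f≡F x = trans (≈⇒eval f (Fₚ ∘ₚ linₚ α β) f≈F x) (trans (eval-F∘lin α β x) (eval-F (t x)))
  g≡G : ∀ x → ⟦ g ⟧ x ≡ (½ * (t x * t x - t x + 1ℚ) + 1ℚ) * q x
  g≡G x = trans (≈⇒eval g (Gₚ ∘ₚ linₚ α β) g≈G x) (trans (eval-G∘lin α β x) (eval-G (t x)))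
  polyt : PolyFun t
  polyt = linear-poly α β
  polyq : PolyFun q
  polyq = κ ½ ⊛ (polyt ⊛ polyt ⊕ polyt ⊕ κ 1ℚ)
  3ℚ : ℚ
  3ℚ = + 3 / 1
  -- This is the cofactor of `q` in f² - f + 1. Replacing t by -t swaps the formulas for `f` and
  -- `q`, which gives the cofactor ½ (t² + 3 t + 3) of `f` in q² - q + 1.
  p₁ : PolyFun (λ x → ½ * (t x * t x - 3ℚ * t x + 3ℚ))
  p₁ = κ ½ ⊛ (polyt ⊛ polyt ⊖ κ 3ℚ ⊛ polyt ⊕ κ 3ℚ)
  -- g = (f + 1) q gives g³ + 1 = (q³ + 1) + f q³ (f² + 3 f + 3), and f divides q² − q + 1.
  p₂ : PolyFun (λ x → (q x + 1ℚ) * (½ * (t x * t x + 3ℚ * t x + 3ℚ))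
                      + q x * q x * q x * (⟦ f ⟧ x * ⟦ f ⟧ x + 3ℚ * ⟦ f ⟧ x + 3ℚ))
  p₂ = (polyq ⊕ κ 1ℚ) ⊛ (κ ½ ⊛ (polyt ⊛ polyt ⊕ κ 3ℚ ⊛ polyt ⊕ κ 3ℚ))
       ⊕ polyq ⊛ polyq ⊛ polyq ⊛ (polynomial f ⊛ polynomial f ⊕ κ 3ℚ ⊛ polynomial f ⊕ κ 3ℚ)
  first : ∀ x → ⟦ cubeₚ f +ₚ constₚ 1ℚ ⟧ x ≡ ⟦ g ⟧ x * (½ * (t x * t x - 3ℚ * t x + 3ℚ))
  first x = trans (eval-cube+1 f x) (trans (cong (λ s → s * s * s + 1ℚ) (f≡F x))
    (trans (lem (t x)) (cong (_* (½ * (t x * t x - 3ℚ * t x + 3ℚ))) (sym (g≡G x)))))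
    where
    lem : ∀ t → ½ * (t * t - t + 1ℚ) * (½ * (t * t - t + 1ℚ)) * (½ * (t * t - t + 1ℚ)) + 1ℚ
        ≡ (½ * (t * t - t + 1ℚ) + 1ℚ) * (½ * (t * t + t + 1ℚ)) * (½ * (t * t - (+ 3 / 1) * t + (+ 3 / 1)))
    lem = solve-∀ ring
  q²-q+1≡fp : ∀ x → q x * q x - q x + 1ℚ ≡ ⟦ f ⟧ x * (½ * (t x * t x + 3ℚ * t x + 3ℚ))
  q²-q+1≡fp x = trans (lem (t x)) (cong (_* (½ * (t x * t x + 3ℚ * t x + 3ℚ))) (sym (f≡F x)))
    where
    lem : ∀ t → ½ * (t * t + t + 1ℚ) * (½ * (t * t + t + 1ℚ)) - ½ * (t * t + t + 1ℚ) + 1ℚ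
        ≡ ½ * (t * t - t + 1ℚ) * (½ * (t * t + (+ 3 / 1) * t + (+ 3 / 1)))
    lem = solve-∀ ring
  g≡[f+1]q : ∀ x → ⟦ g ⟧ x ≡ (⟦ f ⟧ x + 1ℚ) * q x
  g≡[f+1]q x = trans (g≡G x) (cong (λ s → (s + 1ℚ) * q x) (sym (f≡F x)))
  second : ∀ x → ⟦ cubeₚ g +ₚ constₚ 1ℚ ⟧ x
         ≡ ⟦ f ⟧ x * ((q x + 1ℚ) * (½ * (t x * t x + 3ℚ * t x + 3ℚ))
                      + q x * q x * q x * (⟦ f ⟧ x * ⟦ f ⟧ x + 3ℚ * ⟦ f ⟧ x + 3ℚ))
  second x = trans (eval-cube+1 g x) (trans (cong (λ s → s * s * s + 1ℚ) (g≡[f+1]q x))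
    (comb₁ (q x + 1ℚ) (q²-q+1≡fp x) (lem (⟦ f ⟧ x) (q x) (½ * (t x * t x + 3ℚ * t x + 3ℚ)))))
    where
    lem : ∀ f q p → (f + 1ℚ) * q * ((f + 1ℚ) * q) * ((f + 1ℚ) * q) + 1ℚ
                    - f * ((q + 1ℚ) * p + q * q * q * (f * f + (+ 3 / 1) * f + (+ 3 / 1)))
        ≡ (q + 1ℚ) * (q * q - q + 1ℚ - f * p)
    lem = solve-∀ ring

degree-1-injective : ∀ p → HasDegree p 1 → ∀ u v → ⟦ p ⟧ u ≡ ⟦ p ⟧ v → u ≡ v
degree-1-injective (a ∷ b ∷ p) (b≢0 , z) u v eq =
  x-y≡0⇒x≡y (*-cancel-0 b≢0 (comb₁ 1ℚ (trans (sym (value-at u)) (trans eq (value-at v))) (lem a b u v)))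
  where
  lem : ∀ a b u v → b * (u - v) - 0ℚ ≡ 1ℚ * (a + u * b - (a + v * b))
  lem = solve-∀ ring
  value-at : ∀ x → ⟦ a ∷ b ∷ p ⟧ x ≡ a + x * b
  value-at x = trans (cong (λ s → a + x * (b + x * s)) (eval-zero z x)) (eval-lin b a x)

-- deg f = 2 forces deg f₁ = 1, so h takes equal values wherever f does, and then so does g.
-- But F(0) = F(1) while G(0) ≠ G(1).
reparametrisation⇒nontrivial : ∀ f g → HasDegree f 2 → Reparametrisation f g → ¬ Trivial f g
reparametrisation⇒nontrivial f g df (α , β , α≢0 , f≈F , g≈G) (f₁ , g₁ , h , (suc n , 2≤n , dh) , f≈f₁h , g≈g₁h) =
  G0≢G1 (trans (sym (g-at 0ℚ)) (trans g-collapses (g-at 1ℚ)))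
  where
  k : ℚ
  k = proj₁ (inverse α≢0)
  x[_] : ℚ → ℚ
  x[ y ] = k * (y - β)
  t-x : ∀ y → β + x[ y ] * α ≡ y
  t-x y = comb₁ (y - β) (proj₂ (inverse α≢0)) (lem k α β y)
    where
    lem : ∀ k m n y → n + k * (y - n) * m - y ≡ (y - n) * (k * m - 1ℚ)
    lem = solve-∀ ring
  f-at : ∀ y → ⟦ f ⟧ x[ y ] ≡ ⟦ Fₚ ⟧ y
  f-at y = trans (≈⇒eval f (Fₚ ∘ₚ linₚ α β) f≈F x[ y ]) (trans (eval-F∘lin α β x[ y ]) (cong ⟦ Fₚ ⟧ (t-x y)))
  g-at : ∀ y → ⟦ g ⟧ x[ y ] ≡ ⟦ Gₚ ⟧ y
  g-at y = trans (≈⇒eval g (Gₚ ∘ₚ linₚ α β) g≈G x[ y ]) (trans (eval-G∘lin α β x[ y ]) (cong ⟦ Gₚ ⟧ (t-x y)))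
  f≡f₁h : ∀ x → ⟦ f ⟧ x ≡ ⟦ f₁ ⟧ (⟦ h ⟧ x)
  f≡f₁h x = trans (≈⇒eval f (f₁ ∘ₚ h) f≈f₁h x) (eval-∘ f₁ h x)
  g≡g₁h : ∀ x → ⟦ g ⟧ x ≡ ⟦ g₁ ⟧ (⟦ h ⟧ x)
  g≡g₁h x = trans (≈⇒eval g (g₁ ∘ₚ h) g≈g₁h x) (eval-∘ g₁ h x)
  factor-1 : ∀ m n → 2 ℕ.≤ suc n → m ℕ.* suc n ≡ 2 → m ≡ 1
  factor-1 (suc zero) n _ _ = refl
  factor-1 (suc (suc m)) zero (s≤s ()) _
  factor-1 (suc (suc m)) (suc zero) _ ()
  factor-1 (suc (suc m)) (suc (suc n)) _ ()
  df₁ : IsZeroₚ f₁ ⊎ Σ ℕ (HasDegree f₁) → HasDegree f₁ 1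
  df₁ (inj₁ z) = ⊥-elim (zero⇒¬degree 2 (zero-∘ h z) (degree-≈ f (f₁ ∘ₚ h) 2 f≈f₁h df))
  df₁ (inj₂ (m , d)) = subst (HasDegree f₁) (factor-1 m n 2≤n
    (degree-unique (f₁ ∘ₚ h) _ _ (degree-∘ f₁ h m n d dh) (degree-≈ f (f₁ ∘ₚ h) 2 f≈f₁h df))) d
  h-collapses : ⟦ h ⟧ x[ 0ℚ ] ≡ ⟦ h ⟧ x[ 1ℚ ]
  h-collapses = degree-1-injective f₁ (df₁ (zero-or-degree f₁)) _ _
    (trans (sym (f≡f₁h x[ 0ℚ ])) (trans (trans (f-at 0ℚ) (sym (f-at 1ℚ))) (f≡f₁h x[ 1ℚ ])))
  g-collapses : ⟦ g ⟧ x[ 0ℚ ] ≡ ⟦ g ⟧ x[ 1ℚ ]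
  g-collapses = trans (g≡g₁h x[ 0ℚ ]) (trans (cong ⟦ g₁ ⟧ h-collapses) (sym (g≡g₁h x[ 1ℚ ])))
  G0≢G1 : ⟦ Gₚ ⟧ 0ℚ ≢ ⟦ Gₚ ⟧ 1ℚ
  -- The two values compute to 3/4 and 9/4.
  G0≢G1 ()

theorem2p4 : (f g : Poly) → HasDegree f 2 → HasDegree g 4 →
    ((IsSolution f g × ¬ Trivial f g) ⇔
    (Σ ℚ λ α → Σ ℚ λ β → (α ≢ 0ℚ) ×
    (f ≈ₚ Fₚ ∘ₚ linₚ α β) × (g ≈ₚ Gₚ ∘ₚ linₚ α β)))
theorem2p4 f g df dg = mk⇔
  (λ (solution , nontrivial) → solution⇒reparametrisation f g df dg solution nontrivial)
  (λ repar → reparametrisation⇒solution f g repar , reparametrisation⇒nontrivial f g df repar)
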